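{- The logic $\mathsf{GS4}$ is decidable: there is an algorithm which, given a formula $\varphi$ of $\mathcal L$, decides whether $\varphi\in\mathsf{GS4}$.
   Context: Fix a countably infinite set $\mathbb P$ of propositional variables. The language $\mathcal L$: $\varphi ::= p \mid \bot \mid (\varphi\wedge\varphi)\mid(\varphi\vee\varphi)\mid(\varphi\to\varphi)\mid\Diamond\varphi\mid\Box\varphi$, $p\in\mathbb P$; $\neg\varphi:=\varphi\to\bot$. A logic is a set of formulas closed under substitution. $\mathsf{CS4}$ is the smallest logic containing all intuitionistic propositional tautologies (in $\mathcal L$) and the axioms $\Box(p\to q)\to(\Box p\to\Box q)$, $\Box(p\to q)\to(\Diamond p\to\Diamond q)$, $\Box p\to p$, $p\to\Diamond p$, $\Diamond\Diamond p\to\Diamond p$, $\Box p\to\Box\Box p$, and closed under modus ponens and necessitation (from $\varphi$ infer $\Box\varphi$). $\mathsf{GS4}$ is the smallest such logic extending $\mathsf{CS4}$ that also contains $\Diamond(p\vee q)\to\Diamond p\vee\Diamond q$, $\neg\Diamond\bot$, $(\Diamond p\to\Box q)\to\Box(p\to q)$ and $(p\to q)\vee(q\to p)$. -}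

module Defs where

open import Data.Nat using (ℕ)

Var : Set
Var = ℕ

infixr 5 _⇒_
infixr 6 _∨̇_
infixr 7 _∧̇_
data Form : Set where
  var  : Var → Form
  ⊥̇    : Form
  _∧̇_  : Form → Form → Form
  _∨̇_  : Form → Form → Form
  _⇒_  : Form → Form → Form
  ◇    : Form → Form
  □    : Form → Form

¬̇_ : Form → Form
¬̇ φ = φ ⇒ ⊥̇

-- Intuitionistic propositional tautologies in the language 𝓛:
-- theorems of a standard Hilbert calculus for IPC whose axiom schemes
-- range over all formulas of 𝓛 (modal formulas behave as atoms), closed
-- under modus ponens.  These are exactly the substitution instances in 𝓛
-- of intuitionistic propositional tautologies.
data IPC : Form → Set where
  k    : ∀ φ ψ → IPC (φ ⇒ ψ ⇒ φ)
  s    : ∀ φ ψ χ → IPC ((φ ⇒ ψ ⇒ χ) ⇒ (φ ⇒ ψ) ⇒ φ ⇒ χ)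
  ∧e₁  : ∀ φ ψ → IPC (φ ∧̇ ψ ⇒ φ)
  ∧e₂  : ∀ φ ψ → IPC (φ ∧̇ ψ ⇒ ψ)
  ∧i   : ∀ φ ψ → IPC (φ ⇒ ψ ⇒ φ ∧̇ ψ)
  ∨i₁  : ∀ φ ψ → IPC (φ ⇒ φ ∨̇ ψ)
  ∨i₂  : ∀ φ ψ → IPC (ψ ⇒ φ ∨̇ ψ)
  ∨e   : ∀ φ ψ χ → IPC ((φ ⇒ χ) ⇒ (ψ ⇒ χ) ⇒ φ ∨̇ ψ ⇒ χ)
  efq  : ∀ φ → IPC (⊥̇ ⇒ φ)
  mp   : ∀ {φ ψ} → IPC (φ ⇒ ψ) → IPC φ → IPC ψ

-- GS4: the smallest set of formulas containing all intuitionistic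
-- tautologies, all substitution instances of the CS4 and GS4 axioms,
-- closed under modus ponens and necessitation.  (Since the axioms are
-- given as schemes over all formulas, the resulting set is closed under
-- substitution, hence is the smallest logic with these properties.)
data GS4 : Form → Set where
  ipc   : ∀ {φ} → IPC φ → GS4 φ
  K□    : ∀ p q → GS4 (□ (p ⇒ q) ⇒ □ p ⇒ □ q)
  K◇    : ∀ p q → GS4 (□ (p ⇒ q) ⇒ ◇ p ⇒ ◇ q)
  T□    : ∀ p → GS4 (□ p ⇒ p)
  T◇    : ∀ p → GS4 (p ⇒ ◇ p)
  4◇    : ∀ p → GS4 (◇ (◇ p) ⇒ ◇ p)
  4□    : ∀ p → GS4 (□ p ⇒ □ (□ p))
  C◇∨   : ∀ p q → GS4 (◇ (p ∨̇ q) ⇒ ◇ p ∨̇ ◇ q)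
  N◇    : GS4 (¬̇ ◇ ⊥̇)
  FS    : ∀ p q → GS4 ((◇ p ⇒ □ q) ⇒ □ (p ⇒ q))
  GD    : ∀ p q → GS4 ((p ⇒ q) ∨̇ (q ⇒ p))
  mp    : ∀ {φ ψ} → GS4 (φ ⇒ ψ) → GS4 φ → GS4 ψ
  nec   : ∀ {φ} → GS4 φ → GS4 (□ φ)

{-# OPTIONS --safe #-}
module Submission where

-- Let S consist of ⊥, ⊤ and the subformulas of φ.  In a model whose intuitionistic order is locally
-- linear, the chain above a point is described, as far as S is concerned, by the implications
-- between members of S that hold at the point: they form a linear preorder of "truth values".  So
-- we consider the finitely many sequents (Γ , Δ) that split these implications into true and false
-- ones, and repeatedly discard a sequent that is visibly derivable: because it violates a law of
-- the order, or because a modal formula lacks a witness among the remaining sequents; the latter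
-- makes it derivable by the Fischer Servi and Gödel-Dummett axioms.
--
-- The remaining sequents are the chains of a birelational model.  A world is a chain together
-- with a level χ ∈ S, and two worlds are modally related when they agree on the order between
-- boxed and diamond formulas below their levels.  This relation is a confluent preorder for every
-- set of chains, so that discarding sequents never destroys the frame conditions.

open import Defs
open import Data.Empty using (⊥; ⊥-elim)
open import Data.List.Base 
  using (List; []; _∷_; [_]; _++_; map; filter; length; cartesianProduct; cartesianProductWith)
open import Data.List.Membership.Propositional using (_∈_; find; lose)
open import Data.List.Membership.Propositional.Properties
  using (∈-++⁺ˡ; ∈-++⁺ʳ; ∈-++⁻; ∈-map⁺; ∈-map⁻; ∈-∃++; ∈-map∘filter⁺; ∈-map∘filter⁻;
         ∈-cartesianProduct⁺; ∈-cartesianProduct⁻; ∈-cartesianProductWith⁺)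
open import Data.List.Properties using (length-++-sucʳ)
open import Data.List.Relation.Binary.Subset.Propositional using (_⊆_)
open import Data.List.Relation.Unary.All using (All; []; _∷_; all?)
import Data.List.Relation.Unary.All as All
open import Data.List.Relation.Unary.Any using (here; there; any?)
open import Data.Maybe.Base using (Maybe; just; nothing; zipWith)
import Data.Maybe.Base as Maybe
open import Data.Nat.Base using (zero; suc; _≤_; s≤s⁻¹)
import Data.Nat.Properties as ℕ
open import Data.Product using (∃; _×_; _,_; proj₁; proj₂)
open import Data.Sum using (_⊎_; inj₁; inj₂; [_,_]′)
import Data.Sum as Sum
open import Function using (_∘_; id; case_of_)
open import Relation.Binary.Definitions using (DecidableEquality)
open import Relation.Binary.PropositionalEquality using (_≡_; refl; sym; trans; cong; cong₂; subst)
open import Relation.Nullary using (Dec; yes; no; ¬_)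
open import Relation.Nullary.Decidable using (_×-dec_; _⊎-dec_; _→-dec_)

pattern #0 = here refl
pattern #1 = there #0
pattern #2 = there #1
pattern #3 = there #2
pattern #4 = there #3
pattern #5 = there #4
pattern #6 = there #5

variable
  φ ψ χ α β γ δ : Form
  Γ Δ Δ′ : List Form

-- Decidable equality of formulas

infix 4 _≟?_ _≟_

-- Only positive answers carry a proof, so one catch-all clause settles all mismatched constructors;
-- `≟?-refl` then turns `nothing` into a refutation.
_≟?_ : (φ ψ : Form) → Maybe (φ ≡ ψ)
var x ≟? var y = case x ℕ.≟ y of λ { (yes p) → just (cong var p) ; (no _) → nothing }
⊥̇ ≟? ⊥̇ = just refl
(a ∧̇ b) ≟? (c ∧̇ d) = zipWith (cong₂ _∧̇_) (a ≟? c) (b ≟? d)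
(a ∨̇ b) ≟? (c ∨̇ d) = zipWith (cong₂ _∨̇_) (a ≟? c) (b ≟? d)
(a ⇒ b) ≟? (c ⇒ d) = zipWith (cong₂ _⇒_) (a ≟? c) (b ≟? d)
◇ a ≟? ◇ b = Maybe.map (cong ◇) (a ≟? b)
□ a ≟? □ b = Maybe.map (cong □) (a ≟? b)
_ ≟? _ = nothing

≟?-refl : ∀ φ → ∃ λ p → (φ ≟? φ) ≡ just p
≟?-refl (var x) with x ℕ.≟ x
... | yes _ = _ , refl
... | no ¬p = ⊥-elim (¬p refl)
≟?-refl ⊥̇ = _ , refl
≟?-refl (a ∧̇ b) rewrite proj₂ (≟?-refl a) | proj₂ (≟?-refl b) = _ , refl
≟?-refl (a ∨̇ b) rewrite proj₂ (≟?-refl a) | proj₂ (≟?-refl b) = _ , refl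
≟?-refl (a ⇒ b) rewrite proj₂ (≟?-refl a) | proj₂ (≟?-refl b) = _ , refl
≟?-refl (◇ a) rewrite proj₂ (≟?-refl a) = _ , refl
≟?-refl (□ a) rewrite proj₂ (≟?-refl a) = _ , refl

_≟_ : DecidableEquality Form
φ ≟ ψ with φ ≟? ψ in eq
... | just p = yes p
... | nothing = no λ { refl → case trans (sym eq) (proj₂ (≟?-refl φ)) of λ () }

open import Data.List.Membership.DecPropositional _≟_ using (_∈?_)
open import Data.List.Relation.Binary.Subset.DecPropositional _≟_ using (_⊆?_)

-- Natural deduction over GS4

infix 3 _⊢_
infixl 9 _·_

-- Necessitation enters only through `thm`, never under hypotheses; this is what makes the deduction
-- theorem `ƛ` valid.
data _⊢_ (Γ : List Form) : Form → Set where
  hyp : φ ∈ Γ → Γ ⊢ φ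
  thm : GS4 φ → Γ ⊢ φ
  _·_ : Γ ⊢ φ ⇒ ψ → Γ ⊢ φ → Γ ⊢ ψ

ax : IPC φ → Γ ⊢ φ
ax = thm ∘ ipc

weaken : Γ ⊆ Δ → Γ ⊢ φ → Δ ⊢ φ
weaken σ (hyp x) = hyp (σ x)
weaken σ (thm t) = thm t
weaken σ (d · e) = weaken σ d · weaken σ e

↑ : Γ ⊢ φ → ψ ∷ Γ ⊢ φ
↑ = weaken there

toGS4 : [] ⊢ φ → GS4 φ
toGS4 (thm t) = t
toGS4 (d · e) = mp (toGS4 d) (toGS4 e)

ƛ : φ ∷ Γ ⊢ ψ → Γ ⊢ φ ⇒ ψ
ƛ {φ} (hyp #0) = ax (s φ (φ ⇒ φ) φ) · ax (k φ (φ ⇒ φ)) · ax (k φ φ)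
ƛ (hyp (there x)) = ax (k _ _) · hyp x
ƛ (thm t) = ax (k _ _) · thm t
ƛ (d · e) = ax (s _ _ _) · ƛ d · ƛ e

infix 2 _then_

_then_ : Γ ⊢ φ → φ ∷ Γ ⊢ ψ → Γ ⊢ ψ
d then e = ƛ e · d

⊤̇ : Form
⊤̇ = ⊥̇ ⇒ ⊥̇

⊤̇-intro : Γ ⊢ ⊤̇
⊤̇-intro = ax (efq _)

inl : Γ ⊢ φ → Γ ⊢ φ ∨̇ ψ
inl d = ax (∨i₁ _ _) · d

inr : Γ ⊢ ψ → Γ ⊢ φ ∨̇ ψ
inr d = ax (∨i₂ _ _) · d

cases : Γ ⊢ φ ∨̇ ψ → φ ∷ Γ ⊢ χ → ψ ∷ Γ ⊢ χ → Γ ⊢ χ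
cases d e f = ax (∨e _ _ _) · ƛ e · ƛ f · d

linear : ∀ φ ψ → Γ ⊢ (φ ⇒ ψ) ∨̇ (ψ ⇒ φ)
linear φ ψ = thm (GD φ ψ)

-- Finite disjunctions and linearity

⋁ : List Form → Form
⋁ [] = ⊥̇
⋁ (φ ∷ Δ) = φ ∨̇ ⋁ Δ

⋁-intro : φ ∈ Δ → Γ ⊢ φ → Γ ⊢ ⋁ Δ
⋁-intro #0 d = inl d
⋁-intro (there x) d = inr (⋁-intro x d)

⋁-elim : (∀ {φ} → φ ∈ Δ → Γ ⊢ φ ⇒ χ) → Γ ⊢ ⋁ Δ ⇒ χ
⋁-elim {[]} f = ax (efq _)
⋁-elim {φ ∷ Δ} f = ax (∨e _ _ _) · f #0 · ⋁-elim (f ∘ there)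

⋁-mono : Δ ⊆ Δ′ → Γ ⊢ ⋁ Δ → Γ ⊢ ⋁ Δ′
⋁-mono σ d = ⋁-elim (λ x → ƛ (⋁-intro (σ x) (hyp #0))) · d

cut : φ ∷ Γ ⊢ ⋁ Δ → Γ ⊢ ⋁ (φ ∷ Δ) → Γ ⊢ ⋁ Δ
cut d e = cases e d (hyp #0)

-- Compare `β` with `β ⇒ δ`: one direction contracts to `β ⇒ δ`, the other lets `β ⇒ δ` be applied
-- to its own consequence `β`.
⇒-dichotomy : ∀ β δ → Γ ⊢ (β ⇒ δ) ∨̇ ((β ⇒ δ) ⇒ δ)
⇒-dichotomy β δ = cases (linear β (β ⇒ δ))
  (inl (ƛ (hyp #1 · hyp #0 · hyp #0)))
  (inr (ƛ (hyp #0 · (hyp #1 · hyp #0))))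

⋁-dichotomy : (∀ {φ} → φ ∈ Δ → Γ ⊢ φ ∨̇ (φ ⇒ χ)) → Γ ⊢ ⋁ Δ ∨̇ (⋁ Δ ⇒ χ)
⋁-dichotomy {[]} f = inr (ax (efq _))
⋁-dichotomy {φ ∷ Δ} f = cases (f #0) (inl (inl (hyp #0)))
  (cases (↑ (⋁-dichotomy (f ∘ there))) (inl (inr (hyp #0)))
    (inr (ax (∨e _ _ _) · hyp #1 · hyp #0)))

-- In a chain, an implication into a finite join is an implication into one of the joinands.
⇒-⋁-elim : Γ ⊢ φ ⇒ ⋁ Δ → Γ ⊢ (φ ⇒ ⊥̇) ⇒ χ →
           (∀ {ψ} → ψ ∈ Δ → Γ ⊢ (φ ⇒ ψ) ⇒ χ) → Γ ⊢ χ
⇒-⋁-elim {Δ = []} d f g = f · d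
⇒-⋁-elim {Δ = ψ ∷ Δ} d f g = cases (linear ψ (⋁ Δ))
  (⇒-⋁-elim (ƛ (cases (↑ (↑ d) · hyp #0) (hyp #2 · hyp #0) (hyp #0))) (↑ f) (↑ ∘ g ∘ there))
  (↑ (g #0) · ƛ (cases (↑ (↑ d) · hyp #0) (hyp #0) (hyp #2 · hyp #0)))

-- Modal derivations

□-lift : (∀ {ψ} → ψ ∈ Γ → Δ ⊢ □ ψ) → Γ ⊢ φ → Δ ⊢ □ φ
□-lift f (hyp x) = f x
□-lift f (thm t) = thm (nec t)
□-lift f (d · e) = thm (K□ _ _) · □-lift f d · □-lift f e

-- `C◇∨` and `N◇` distribute `◇` over a finite join, so the property passes from the joinands to the
-- join.
◇-⋁ : (∀ {ψ} → ψ ∈ Δ → Γ ⊢ ◇ ψ ⇒ ψ) → Γ ⊢ ◇ (⋁ Δ) ⇒ ⋁ Δ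
◇-⋁ {[]} f = thm N◇
◇-⋁ {ψ ∷ Δ} f = ƛ (cases (thm (C◇∨ _ _) · hyp #0)
  (inl (↑ (↑ (f #0)) · hyp #0))
  (inr (↑ (↑ (◇-⋁ (f ∘ there))) · hyp #0)))

-- Composing `δ ⇒ β` with both hypotheses gives `◇ δ ⇒ □ β`, the premise of `FS`.
□-⇒ : Γ ⊢ ◇ δ ⇒ δ → Γ ⊢ β ⇒ □ β → Γ ⊢ (δ ⇒ β) ⇒ □ (δ ⇒ β)
□-⇒ d e = ƛ (thm (FS _ _) · ƛ (↑ (↑ e) · (hyp #1 · (↑ (↑ d) · hyp #0))))

-- Given `□ β`, evaluation at `β` is a boxed implication from `β ⇒ δ` to `δ`, which `K◇` carries
-- through the diamond.
◇-⇒ : Γ ⊢ β ⇒ □ β → Γ ⊢ ◇ δ ⇒ δ → Γ ⊢ ◇ (β ⇒ δ) ⇒ β ⇒ δ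
◇-⇒ e d = ƛ (ƛ (↑ (↑ d) · (thm (K◇ _ _) · (evaluate · (↑ (↑ e) · hyp #0)) · hyp #1)))
  where
  evaluate : Γ ⊢ □ φ ⇒ □ ((φ ⇒ ψ) ⇒ ψ)
  evaluate = thm (K□ _ _) · thm (nec (toGS4 (ƛ (ƛ (hyp #0 · hyp #1)))))

-- Birelational semantics

-- Disjunction and ◇ are read classically, which makes forcing ¬¬-stable and GD valid constructively.
record Model : Set₁ where
  infix 4 _≼_ _⊑_ _⊩_
  field
    World    : Set
    _≼_ _⊑_  : World → World → Set
    V        : World → Var → Set
    ≼-refl   : ∀ {w} → w ≼ w
    ≼-trans  : ∀ {u v w} → u ≼ v → v ≼ w → u ≼ w
    ⊑-refl   : ∀ {w} → w ⊑ w
    ⊑-trans  : ∀ {u v w} → u ⊑ v → v ⊑ w → u ⊑ w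
    ≼-linear : ∀ {w u v} → w ≼ u → w ≼ v → u ≼ v ⊎ v ≼ u
    -- `forth` makes diamonds persistent; `back` validates `4□` and `FS`.
    forth    : ∀ {w w′ v} → w ≼ w′ → w ⊑ v → ∃ λ v′ → v ≼ v′ × w′ ⊑ v′
    back     : ∀ {w v v′} → w ⊑ v → v ≼ v′ → ∃ λ w′ → w ≼ w′ × w′ ⊑ v′
    V-mono   : ∀ {w v p} → w ≼ v → V w p → V v p

  _⊩_ : World → Form → Set
  w ⊩ var p = ¬ ¬ V w p
  w ⊩ ⊥̇ = ⊥
  w ⊩ φ ∧̇ ψ = w ⊩ φ × w ⊩ ψ
  w ⊩ φ ∨̇ ψ = ¬ ¬ (w ⊩ φ ⊎ w ⊩ ψ)
  w ⊩ φ ⇒ ψ = ∀ {v} → w ≼ v → v ⊩ φ → v ⊩ ψ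
  w ⊩ ◇ φ = ¬ ¬ (∃ λ v → w ⊑ v × v ⊩ φ)
  w ⊩ □ φ = ∀ {u v} → w ≼ u → u ⊑ v → v ⊩ φ

  stable : ∀ φ {w} → ¬ ¬ (w ⊩ φ) → w ⊩ φ
  stable (var p) h κ = h λ f → f κ
  stable ⊥̇ h = h id
  stable (φ ∧̇ ψ) h = stable φ (λ κ → h (κ ∘ proj₁)) , stable ψ (λ κ → h (κ ∘ proj₂))
  stable (φ ∨̇ ψ) h κ = h λ f → f κ
  stable (φ ⇒ ψ) h w≼v x = stable ψ λ κ → h λ f → κ (f w≼v x)
  stable (◇ φ) h κ = h λ f → f κ
  stable (□ φ) h w≼u u⊑v = stable φ λ κ → h λ f → κ (f w≼u u⊑v)

  mono : ∀ φ {w v} → w ≼ v → w ⊩ φ → v ⊩ φ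
  mono (var p) w≼v x κ = x λ y → κ (V-mono w≼v y)
  mono (φ ∧̇ ψ) w≼v (x , y) = mono φ w≼v x , mono ψ w≼v y
  mono (φ ∨̇ ψ) w≼v x κ = x λ
    { (inj₁ y) → κ (inj₁ (mono φ w≼v y))
    ; (inj₂ y) → κ (inj₂ (mono ψ w≼v y)) }
  mono (φ ⇒ ψ) w≼v x v≼u = x (≼-trans w≼v v≼u)
  mono (◇ φ) w≼v x κ = x λ (u , w⊑u , y) →
    let u′ , u≼u′ , v⊑u′ = forth w≼v w⊑u in κ (u′ , v⊑u′ , mono φ u≼u′ y)
  mono (□ φ) w≼v x v≼u = x (≼-trans w≼v v≼u)

  sound-IPC : IPC φ → ∀ {w} → w ⊩ φ
  sound-IPC (k φ ψ) _ x w≼v _ = mono φ w≼v x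
  sound-IPC (s φ ψ χ) _ f p g q x = f (≼-trans p q) x ≼-refl (g q x)
  sound-IPC (∧e₁ φ ψ) _ = proj₁
  sound-IPC (∧e₂ φ ψ) _ = proj₂
  sound-IPC (∧i φ ψ) _ x p y = mono φ p x , y
  sound-IPC (∨i₁ φ ψ) _ x κ = κ (inj₁ x)
  sound-IPC (∨i₂ φ ψ) _ x κ = κ (inj₂ x)
  sound-IPC (∨e φ ψ χ) _ f p g q x = stable χ λ κ → x [ κ ∘ f (≼-trans p q) , κ ∘ g q ]′
  sound-IPC (efq φ) _ ()
  sound-IPC (mp d e) = sound-IPC d ≼-refl (sound-IPC e)

  sound : GS4 φ → ∀ {w} → w ⊩ φ
  sound (ipc d) = sound-IPC d
  sound (K□ φ ψ) _ f p x q r = f (≼-trans p q) r ≼-refl (x q r)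
  sound (K◇ φ ψ) _ f p x κ = x λ (v , r , y) → κ (v , r , f p r ≼-refl y)
  sound (T□ φ) _ x = x ≼-refl ⊑-refl
  sound (T◇ φ) _ x κ = κ (_ , ⊑-refl , x)
  sound (4◇ φ) _ x κ = x λ (v , r , y) → y λ (u , r′ , z) → κ (u , ⊑-trans r r′ , z)
  sound (4□ φ) _ x p r q r′ =
    let _ , q′ , r″ = back r q in x (≼-trans p q′) (⊑-trans r″ r′)
  sound (C◇∨ φ ψ) _ x κ = x λ (v , r , y) → y λ
    { (inj₁ z) → κ (inj₁ λ κ′ → κ′ (v , r , z))
    ; (inj₂ z) → κ (inj₂ λ κ′ → κ′ (v , r , z)) }
  sound N◇ _ x = x λ (_ , _ , y) → y
  sound (FS φ ψ) _ f p r q x =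
    let _ , q′ , r′ = back r q
    in f (≼-trans p q′) (λ κ → κ (_ , r′ , x)) ≼-refl r′
  -- If both disjuncts fail, one later world forces `φ` without `ψ` and another `ψ` without `φ`;
  -- linearity and persistence exclude this.
  sound (GD φ ψ) κ = κ (inj₁ λ p x → stable ψ λ ¬y → κ (inj₂ λ q y → stable φ λ ¬x →
    [ (λ u → ¬x (mono φ u x)) , (λ u → ¬y (mono ψ u y)) ]′ (≼-linear p q)))
  sound (mp d e) = sound d ≼-refl (sound e)
  sound (nec d) _ _ = sound d

-- Sequents and their completions

Sequent : Set
Sequent = List Form × List Form

infix 4 _⊑ˢ_

_⊑ˢ_ : Sequent → Sequent → Set
(Γ , Δ) ⊑ˢ (Γ′ , Δ′) = Γ ⊆ Γ′ × Δ ⊆ Δ′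

_⊑ˢ?_ : ∀ P Q → Dec (P ⊑ˢ Q)
(Γ , Δ) ⊑ˢ? (Γ′ , Δ′) = (Γ ⊆? Γ′) ×-dec (Δ ⊆? Δ′)

Derivable : Sequent → Set
Derivable (Γ , Δ) = Γ ⊢ ⋁ Δ

Derivable-mono : ∀ {P Q} → P ⊑ˢ Q → Derivable P → Derivable Q
Derivable-mono (σ , τ) d = ⋁-mono τ (weaken σ d)

-- The failure side carries data: a derivation in the checks on sequents, an element to discard in
-- `prune`.
allOr : {A : Set} {P : A → Set} {Q : Set} (xs : List A) →
        (∀ {x} → x ∈ xs → P x ⊎ Q) → (∀ {x} → x ∈ xs → P x) ⊎ Q
allOr [] f = inj₁ λ ()
allOr {P = P} (x ∷ xs) f with f #0 | allOr {P = P} xs (f ∘ there)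
... | inj₂ q | _ = inj₂ q
... | inj₁ _ | inj₂ q = inj₂ q
... | inj₁ p | inj₁ g = inj₁ λ { #0 → p ; (there y) → g y }

givenOr : {A B Q : Set} → Dec A → (A → B ⊎ Q) → (A → B) ⊎ Q
givenOr (yes a) f = Sum.map₁ (λ b _ → b) (f a)
givenOr (no ¬a) f = inj₁ (⊥-elim ∘ ¬a)

-- Pruning a finite set of candidates

Exhausts : {A : Set} → (A → Set) → List A → List A → Set
Exhausts D U X = ∀ {x} → x ∈ U → x ∈ X ⊎ D x

-- Goodness refers to the current list, so all members are rechecked after each removal. The length
-- bounds the number of rounds, and `Exhausts` is the invariant.
prune : {A : Set} {D : A → Set} {G : List A → A → Set} (U : List A) →
        (∀ {X} → Exhausts D U X → ∀ x → G X x ⊎ D x) →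
        ∃ λ X → Exhausts D U X × X ⊆ U × (∀ {x} → x ∈ X → G X x)
prune {A} {D} {G} U good? = go (length U) U ℕ.≤-refl inj₁ id
  where
  go : ∀ n X → length X ≤ n → Exhausts D U X → X ⊆ U →
       ∃ λ X → Exhausts D U X × X ⊆ U × (∀ {x} → x ∈ X → G X x)
  go n X X≤n ex X⊆ with allOr {P = G X} {Q = ∃ λ x → x ∈ X × D x} X
                          (λ {x} x∈ → Sum.map₂ (λ d → x , x∈ , d) (good? ex x))
  ... | inj₁ good = X , ex , X⊆ , good
  ... | inj₂ (x , x∈ , d) with ∈-∃++ x∈
  go zero _ X≤n ex X⊆ | inj₂ (x , _ , d) | Y , Z , refl =
    ⊥-elim (ℕ.n≮0 (subst (_≤ 0) (length-++-sucʳ Y x Z) X≤n))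
  go (suc n) _ X≤n ex X⊆ | inj₂ (x , _ , d) | Y , Z , refl =
    go n (Y ++ Z) (s≤s⁻¹ (subst (_≤ suc n) (length-++-sucʳ Y x Z) X≤n)) ex′ (X⊆ ∘ embed)
    where
    embed : Y ++ Z ⊆ Y ++ x ∷ Z
    embed y = [ ∈-++⁺ˡ , ∈-++⁺ʳ Y ∘ there ]′ (∈-++⁻ Y y)

    ex′ : Exhausts D U (Y ++ Z)
    ex′ y∈ with ex y∈
    ... | inj₂ e = inj₂ e
    ... | inj₁ m with ∈-++⁻ Y m
    ...   | inj₁ y = inj₁ (∈-++⁺ˡ y)
    ...   | inj₂ #0 = inj₂ d
    ...   | inj₂ (there z) = inj₁ (∈-++⁺ʳ Y z)

-- Complete splits of a list of formulas

consˡ consʳ : Form → Sequent → Sequent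
consˡ φ (Γ , Δ) = φ ∷ Γ , Δ
consʳ φ (Γ , Δ) = Γ , φ ∷ Δ

splits : List Form → List Sequent
splits [] = [ [] , [] ]
splits (φ ∷ Γ) = map (consˡ φ) (splits Γ) ++ map (consʳ φ) (splits Γ)

splits-cover : ∀ {P} → P ∈ splits Γ → φ ∈ Γ → φ ∈ proj₁ P ⊎ φ ∈ proj₂ P
splits-cover {ψ ∷ Γ} P∈ φ∈ with ∈-++⁻ (map (consˡ ψ) (splits Γ)) P∈
... | inj₁ m with ∈-map⁻ (consˡ ψ) m | φ∈
...   | _ , _ , refl | #0 = inj₁ #0
...   | _ , Q∈ , refl | there φ∈′ = Sum.map₁ there (splits-cover Q∈ φ∈′)
splits-cover {ψ ∷ Γ} P∈ φ∈ | inj₂ m with ∈-map⁻ (consʳ ψ) m | φ∈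
...   | _ , _ , refl | #0 = inj₂ #0
...   | _ , Q∈ , refl | there φ∈′ = Sum.map₂ there (splits-cover Q∈ φ∈′)

shift-⊆ : ∀ Γ → φ ∷ Γ ++ Δ ⊆ Γ ++ φ ∷ Δ
shift-⊆ Γ #0 = ∈-++⁺ʳ Γ #0
shift-⊆ Γ (there x) = [ ∈-++⁺ˡ , ∈-++⁺ʳ Γ ∘ there ]′ (∈-++⁻ Γ x)

splits-cut : ∀ Γ {A B} → (∀ {P} → P ∈ splits Γ → Derivable (proj₁ P ++ A , proj₂ P ++ B)) →
             Derivable (A , B)
splits-cut [] f = f #0
splits-cut (φ ∷ Γ) f = cut
  (splits-cut Γ λ {P} P∈ → Derivable-mono (shift-⊆ (proj₁ P) , id)
    (f (∈-++⁺ˡ (∈-map⁺ (consˡ φ) P∈))))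
  (splits-cut Γ λ {P} P∈ → Derivable-mono (id , shift-⊆ (proj₂ P))
    (f (∈-++⁺ʳ (map (consˡ φ) (splits Γ)) (∈-map⁺ (consʳ φ) P∈))))

-- A finite Lindenbaum lemma: cut on every member of `Γ`. A split that does not extend `R` has a
-- formula of `R` on the opposite side, which closes that branch at once.
completion : ∀ {R} → proj₁ R ⊆ Γ → proj₂ R ⊆ Γ →
             (∀ {P} → P ∈ splits Γ → R ⊑ˢ P → Derivable P) → Derivable R
completion {Γ} {A , B} A⊆ B⊆ f = splits-cut Γ λ {P} P∈ → go P P∈
  where
  go : ∀ P → P ∈ splits Γ → Derivable (proj₁ P ++ A , proj₂ P ++ B)
  go P P∈ with allOr {P = _∈ proj₁ P} A (λ x → Sum.map₂
                 (λ y → ⋁-intro (∈-++⁺ˡ y) (hyp (∈-++⁺ʳ (proj₁ P) x))) (splits-cover P∈ (A⊆ x)))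
  ... | inj₂ d = d
  ... | inj₁ A⊆P with allOr {P = _∈ proj₂ P} B (λ x → Sum.map₂
                 (λ y → ⋁-intro (∈-++⁺ʳ (proj₂ P) x) (hyp (∈-++⁺ˡ y)))
                 (Sum.swap (splits-cover P∈ (B⊆ x))))
  ...   | inj₂ d = d
  ...   | inj₁ B⊆P = Derivable-mono (∈-++⁺ˡ , ∈-++⁺ˡ) (f P∈ (A⊆P , B⊆P))

-- The local rules of a linear preorder of truth values

-- Each rule is coded as a forbidden pattern: premises hold on the left while all conclusions fail
-- on the right.
rules : (φ ψ χ : Form) → List Sequent
rules φ ψ χ =
    ([ φ ⇒ ψ ]                 , [ φ ⇒ ψ ])
  ∷ ([]                        , [ φ ⇒ φ ])
  ∷ ((φ ⇒ ψ) ∷ (ψ ⇒ χ) ∷ []    , [ φ ⇒ χ ])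
  ∷ ([]                        , (φ ⇒ ψ) ∷ (ψ ⇒ φ) ∷ [])
  ∷ ([ ⊤̇ ⇒ ⊥̇ ]                 , [])
  ∷ ([]                        , [ ⊥̇ ⇒ φ ])
  ∷ ([]                        , [ φ ⇒ ⊤̇ ])
  ∷ ([]                       , [ φ ∧̇ ψ ⇒ φ ])
  ∷ ([]                        , [ φ ∧̇ ψ ⇒ ψ ])
  ∷ ((χ ⇒ φ) ∷ (χ ⇒ ψ) ∷ []    , [ χ ⇒ φ ∧̇ ψ ])
  ∷ ([]                        , [ φ ⇒ φ ∨̇ ψ ])
  ∷ ([]                        , [ ψ ⇒ φ ∨̇ ψ ])
  ∷ ((φ ⇒ χ) ∷ (ψ ⇒ χ) ∷ []    , [ φ ∨̇ ψ ⇒ χ ])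
  ∷ ([]                       , [ ψ ⇒ φ ⇒ ψ ])
  ∷ ((χ ⇒ φ) ∷ (χ ⇒ φ ⇒ ψ) ∷ [] , [ χ ⇒ ψ ])
  ∷ ([ φ ⇒ ψ ]                 , [ ⊤̇ ⇒ φ ⇒ ψ ])
  ∷ ([]                        , [ □ φ ⇒ φ ])
  ∷ ([]                        , [ φ ⇒ ◇ φ ])
  ∷ []

pattern rule-consistent = #0
pattern rule-refl       = #1
pattern rule-trans      = #2
pattern rule-total      = #3
pattern rule-⊤≰⊥        = #4
pattern rule-⊥          = #5
pattern rule-⊤          = #6
pattern rule-∧₁         = there rule-⊤
pattern rule-∧₂         = there rule-∧₁
pattern rule-∧          = there rule-∧₂
pattern rule-∨₁         = there rule-∧
pattern rule-∨₂         = there rule-∨₁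
pattern rule-∨          = there rule-∨₂
pattern rule-K          = there rule-∨
pattern rule-mp         = there rule-K
pattern rule-⇒          = there rule-mp
pattern rule-□          = there rule-⇒
pattern rule-◇          = there rule-□

rules-derivable : ∀ φ ψ χ → All Derivable (rules φ ψ χ)
rules-derivable φ ψ χ =
    inl (hyp #0)
  ∷ inl (ƛ (hyp #0))
  ∷ inl (ƛ (hyp #2 · (hyp #1 · hyp #0)))
  ∷ cases (linear φ ψ) (inl (hyp #0)) (inr (inl (hyp #0)))
  ∷ hyp #0 · ⊤̇-intro
  ∷ inl (ax (efq _))
  ∷ inl (ƛ ⊤̇-intro)
  ∷ inl (ax (∧e₁ _ _))
  ∷ inl (ax (∧e₂ _ _))
  ∷ inl (ƛ (ax (∧i _ _) · (hyp #1 · hyp #0) · (hyp #2 · hyp #0)))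
  ∷ inl (ax (∨i₁ _ _))
  ∷ inl (ax (∨i₂ _ _))
  ∷ inl (ax (∨e _ _ _) · hyp #0 · hyp #1)
  ∷ inl (ax (k _ _))
  ∷ inl (ƛ (hyp #2 · hyp #0 · (hyp #1 · hyp #0)))
  ∷ inl (ƛ (hyp #1))
  ∷ inl (thm (T□ _))
  ∷ inl (thm (T◇ _))
  ∷ []

-- These formulas are fixed by `□` and by `◇` respectively. With `⊤̇` and `⊥̇` in both lists, truth
-- of a single box or diamond and consistency of a level become instances of comparisons.
boxes dias : List Form → List Form
boxes S = ⊤̇ ∷ ⊥̇ ∷ map □ S
dias S = ⊥̇ ∷ ⊤̇ ∷ map ◇ S

box-□ : ∀ {S} → β ∈ boxes S → Γ ⊢ β ⇒ □ β
box-□ #0 = ƛ (thm (nec (toGS4 ⊤̇-intro)))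
box-□ #1 = ax (efq _)
box-□ (there (there x)) with ∈-map⁻ □ x
... | _ , _ , refl = thm (4□ _)

dia-◇ : ∀ {S} → δ ∈ dias S → Γ ⊢ ◇ δ ⇒ δ
dia-◇ #0 = thm N◇
dia-◇ #1 = ƛ ⊤̇-intro
dia-◇ (there (there x)) with ∈-map⁻ ◇ x
... | _ , _ , refl = thm (4◇ _)

infix 4 _≤[_]_

_≤[_]_ : Form → Sequent → Form → Set
φ ≤[ P ] ψ = φ ⇒ ψ ∈ proj₁ P

-- The order of truth values seen at level χ, where everything above χ is identified with ⊤̇.
Below : Sequent → Form → Form → Form → Set
Below P χ φ ψ = χ ≤[ P ] ψ ⊎ φ ≤[ P ] ψ

-- Subformulas

sub : Form → List Form
sub φ@(var _) = [ φ ]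
sub φ@⊥̇ = [ φ ]
sub φ@(ψ ∧̇ χ) = φ ∷ sub ψ ++ sub χ
sub φ@(ψ ∨̇ χ) = φ ∷ sub ψ ++ sub χ
sub φ@(ψ ⇒ χ) = φ ∷ sub ψ ++ sub χ
sub φ@(◇ ψ) = φ ∷ sub ψ
sub φ@(□ ψ) = φ ∷ sub ψ

self∈sub : ∀ φ → φ ∈ sub φ
self∈sub (var _) = #0
self∈sub ⊥̇ = #0
self∈sub (_ ∧̇ _) = #0
self∈sub (_ ∨̇ _) = #0
self∈sub (_ ⇒ _) = #0
self∈sub (◇ _) = #0
self∈sub (□ _) = #0

subˡ : ∀ φ ψ → χ ∷ sub φ ++ sub ψ ⊆ Γ → sub φ ⊆ Γ
subˡ φ ψ σ = σ ∘ there ∘ ∈-++⁺ˡ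

subʳ : ∀ φ ψ → χ ∷ sub φ ++ sub ψ ⊆ Γ → sub ψ ⊆ Γ
subʳ φ ψ σ = σ ∘ there ∘ ∈-++⁺ʳ (sub φ)

-- Elimination of derivable sequents

module Elimination (S : List Form) (⊥∈S : ⊥̇ ∈ S) (⊤∈S : ⊤̇ ∈ S) where

  Imps : List Form
  Imps = cartesianProductWith _⇒_ S S

  ⇒∈Imps : φ ∈ S → ψ ∈ S → φ ⇒ ψ ∈ Imps
  ⇒∈Imps = ∈-cartesianProductWith⁺ _⇒_

  -- The demands on a modal successor: by `□-⇒` a diamond-to-box comparison true at level `χ` must
  -- stay true, and by `◇-⇒` a box-to-diamond comparison failing there must stay false.
  Upper Lower : Sequent → Form → Form × Form → Set
  Upper P χ (δ , β) = δ ∈ dias S × β ∈ boxes S × Below P χ δ β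
  Lower P χ (β , δ) = β ∈ boxes S × δ ∈ dias S × χ ⇒ δ ∈ proj₂ P × β ⇒ δ ∈ proj₂ P

  upper? : ∀ P χ p → Dec (Upper P χ p)
  upper? P χ (δ , β) =
    (δ ∈? dias S) ×-dec (β ∈? boxes S) ×-dec ((χ ⇒ β ∈? proj₁ P) ⊎-dec (δ ⇒ β ∈? proj₁ P))

  lower? : ∀ P χ p → Dec (Lower P χ p)
  lower? P χ (β , δ) =
    (β ∈? boxes S) ×-dec (δ ∈? dias S) ×-dec (χ ⇒ δ ∈? proj₂ P) ×-dec (β ⇒ δ ∈? proj₂ P)

  imp : Form × Form → Form
  imp (φ , ψ) = φ ⇒ ψ

  upper lower : Sequent → Form → List Form
  upper P χ = map imp (filter (upper? P χ) (cartesianProduct S S))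
  lower P χ = map imp (filter (lower? P χ) (cartesianProduct S S))

  upper⊆ : ∀ {P χ} → upper P χ ⊆ Imps
  upper⊆ {P} {χ} x with ∈-map∘filter⁻ imp (upper? P χ) {xs = cartesianProduct S S} x
  ... | (δ , β) , y , refl , _ = let p , q = ∈-cartesianProduct⁻ S S y in ⇒∈Imps p q

  lower⊆ : ∀ {P χ} → lower P χ ⊆ Imps
  lower⊆ {P} {χ} x with ∈-map∘filter⁻ imp (lower? P χ) {xs = cartesianProduct S S} x
  ... | (δ , β) , y , refl , _ = let p , q = ∈-cartesianProduct⁻ S S y in ⇒∈Imps p q

  upper-□ : ∀ {P} → φ ∈ upper P χ → χ ∷ proj₁ P ⊢ □ φ
  upper-□ {χ = χ} {P} x with ∈-map∘filter⁻ imp (upper? P χ) {xs = cartesianProduct S S} x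
  ... | (δ , β) , _ , refl , d , b , l = □-⇒ (dia-◇ d) (box-□ b) ·
    [ (λ y → ƛ (hyp (there (there y)) · hyp #1)) , (λ y → hyp (there y)) ]′ l

  lower-◇ : ∀ {P} → φ ∈ lower P χ → Γ ⊢ ◇ φ ⇒ φ
  lower-◇ {χ = χ} {P = P} x with ∈-map∘filter⁻ imp (lower? P χ) {xs = cartesianProduct S S} x
  ... | _ , _ , refl , b , d , _ = ◇-⇒ (box-□ b) (dia-◇ d)

  -- For `φ` of the form `β ⇒ δ`, compare `χ` with `β`: the smaller of the two implies `δ`, and both
  -- such implications are on the right of `P`.
  lower-out : ∀ {P} → φ ∈ lower P χ → Γ ⊢ (χ ⇒ φ) ⇒ ⋁ (proj₂ P)
  lower-out {χ = χ} {P = P} x with ∈-map∘filter⁻ imp (lower? P χ) {xs = cartesianProduct S S} x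
  ... | (β , δ) , _ , refl , _ , _ , y , z = ƛ (cases (linear χ β)
    (⋁-intro y (ƛ (hyp #2 · hyp #0 · (hyp #1 · hyp #0))))
    (⋁-intro z (ƛ (hyp #2 · (hyp #1 · hyp #0) · hyp #0))))

  ◇-step : ∀ {P} → ◇ φ ⇒ ⊥̇ ∈ proj₂ P →
           Derivable ((⊤̇ ⇒ φ) ∷ upper P (◇ φ) , lower P (◇ φ)) → Derivable P
  ◇-step {φ} {P} out d =
    ⇒-⋁-elim (ƛ (◇-⋁ (lower-◇ {P = P}) · ◇⋁)) (ƛ (⋁-intro out (hyp #0))) (lower-out {P = P})
    where
    ◇⋁ : ◇ φ ∷ proj₁ P ⊢ ◇ (⋁ (lower P (◇ φ)))
    ◇⋁ = thm (K◇ _ _) · □-lift (upper-□ {P = P}) (ƛ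
      (ƛ (hyp #1) then weaken (λ { #0 → #0 ; (there x) → there (there x) }) d)) · hyp #0

  -- Boxing `d` leaves a join under `□`, which need not distribute. The minimality hypothesis, that
  -- whatever fails at level `χ` lies below `□ φ`, makes up for this.
  □-step : ∀ {P} → χ ⇒ □ φ ∈ proj₂ P →
           (∀ {δ} → δ ∈ S → χ ⇒ δ ∈ proj₂ P → δ ⇒ □ φ ∈ proj₁ P) →
           Derivable (upper P χ , (⊤̇ ⇒ φ) ∷ lower P χ) → Derivable P
  □-step {χ} {φ} {P} out minimal d = ⇒-⋁-elim {Δ = □ φ ∷ L} (ƛ split)
    (ƛ (⋁-intro out (ƛ (ax (efq _) · (hyp #1 · hyp #0)))))
    λ { #0 → ƛ (⋁-intro out (hyp #0)) ; (there x) → lower-out {P = P} x }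
    where
    L = lower P χ
    Γ₀ = χ ∷ proj₁ P

    reflection : Γ₀ ⊢ (⋁ L ⇒ □ φ) ⇒ □ φ
    reflection = ƛ (□-lift {Γ = (⋁ L ⇒ φ) ∷ ⋁ ((⊤̇ ⇒ φ) ∷ L) ∷ []}
      (λ { #0 → thm (FS _ _) · ƛ (hyp #1 · (◇-⋁ (lower-◇ {P = P}) · hyp #0))
         ; #1 → ↑ (□-lift (upper-□ {P = P}) d) })
      (cases (hyp #1) (hyp #0 · ⊤̇-intro) (hyp #1 · hyp #0)))

    -- If `β ⇒ δ` collapses to `δ`, it implies `□ φ`, because `δ` fails at level `χ`.
    dichotomy : ∀ {ψ} → ψ ∈ L → Γ₀ ⊢ ψ ∨̇ (ψ ⇒ □ φ)
    dichotomy x with ∈-map∘filter⁻ imp (lower? P χ) {xs = cartesianProduct S S} x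
    ... | (β , δ) , m , refl , _ , _ , y , _ = cases (⇒-dichotomy β δ) (inl (hyp #0))
      (inr (ƛ (weaken (there ∘ there ∘ there) (hyp (minimal δ∈ y)) · (hyp #1 · hyp #0))))
      where δ∈ = proj₂ (∈-cartesianProduct⁻ S S m)

    split : Γ₀ ⊢ ⋁ (□ φ ∷ L)
    split = cases (⋁-dichotomy dichotomy) (inr (hyp #0)) (inl (↑ reflection · hyp #0))

  WF : Sequent → Set
  WF P = ∀ {φ} → φ ∈ S → ∀ {ψ} → ψ ∈ S → ∀ {χ} → χ ∈ S → ∀ {R} → R ∈ rules φ ψ χ → ¬ R ⊑ˢ P

  wf? : ∀ P → WF P ⊎ Derivable P
  wf? P = allOr S λ {φ} _ → allOr S λ {ψ} _ → allOr S λ {χ} _ → allOr (rules φ ψ χ) λ {R} R∈ →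
    case R ⊑ˢ? P of λ
      { (yes R⊑P) → inj₂ (Derivable-mono R⊑P (All.lookup (rules-derivable φ ψ χ) R∈))
      ; (no R⋢P) → inj₁ R⋢P }

  -- Witnesses are demanded only at critical levels: `◇ φ` itself, or the last level at which `□ φ`
  -- fails. The truth lemma reduces other levels to these. `All` keeps the minimality condition
  -- decidable.
  ◇Wit □Wit : List Sequent → Sequent → Set
  ◇Wit X P = ∀ {φ} → φ ∈ S → ◇ φ ∈ S → ◇ φ ⇒ ⊥̇ ∈ proj₂ P →
             ∃ λ Q → Q ∈ X × ((⊤̇ ⇒ φ) ∷ upper P (◇ φ) , lower P (◇ φ)) ⊑ˢ Q
  □Wit X P = ∀ {φ} → φ ∈ S → □ φ ∈ S → ∀ {χ} → χ ∈ S → χ ⇒ □ φ ∈ proj₂ P →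
             All (λ δ → χ ⇒ δ ∈ proj₂ P → δ ⇒ □ φ ∈ proj₁ P) S →
             ∃ λ Q → Q ∈ X × (upper P χ , (⊤̇ ⇒ φ) ∷ lower P χ) ⊑ˢ Q

  record Good (X : List Sequent) (P : Sequent) : Set where
    constructor mkGood
    field
      wf    : WF P
      ◇-wit : ◇Wit X P
      □-wit : □Wit X P

  Exhaustive : List Sequent → Set
  Exhaustive = Exhausts Derivable (splits Imps)

  -- If no member of `X` extends `R`, every completion of `R` was discarded as derivable, hence so
  -- is `R`.
  search : ∀ {X R} → Exhaustive X → proj₁ R ⊆ Imps → proj₂ R ⊆ Imps →
           (∃ λ Q → Q ∈ X × R ⊑ˢ Q) ⊎ Derivable R
  search {X} {R} ex R₁⊆ R₂⊆ with any? (R ⊑ˢ?_) X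
  ... | yes a = inj₁ (find a)
  ... | no ¬a = inj₂ (completion R₁⊆ R₂⊆ λ P∈ R⊑P →
          [ (λ P∈X → ⊥-elim (¬a (lose P∈X R⊑P))) , id ]′ (ex P∈))

  ◇Wit? : ∀ {X} → Exhaustive X → ∀ P → ◇Wit X P ⊎ Derivable P
  ◇Wit? ex P = allOr S λ {φ} φ∈ → givenOr (◇ φ ∈? S) λ _ →
    givenOr (◇ φ ⇒ ⊥̇ ∈? proj₂ P) λ out →
    Sum.map₂ (◇-step {P = P} out) (search ex
      (λ { #0 → ⇒∈Imps ⊤∈S φ∈ ; (there x) → upper⊆ {P} x }) (lower⊆ {P}))

  □Wit? : ∀ {X} → Exhaustive X → ∀ P → □Wit X P ⊎ Derivable P
  □Wit? ex P = allOr S λ {φ} φ∈ → givenOr (□ φ ∈? S) λ _ → allOr S λ {χ} _ →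
    givenOr (χ ⇒ □ φ ∈? proj₂ P) λ out →
    givenOr (all? (λ δ → (χ ⇒ δ ∈? proj₂ P) →-dec (δ ⇒ □ φ ∈? proj₁ P)) S) λ minimal →
    Sum.map₂ (□-step {P = P} out (All.lookup minimal)) (search ex
      (upper⊆ {P}) (λ { #0 → ⇒∈Imps ⊤∈S φ∈ ; (there x) → lower⊆ {P} x }))

  good? : ∀ {X} → Exhaustive X → ∀ P → Good X P ⊎ Derivable P
  good? {X} ex P = combine (wf? P) (◇Wit? ex P) (□Wit? ex P)
    where
    combine : WF P ⊎ Derivable P → ◇Wit X P ⊎ Derivable P → □Wit X P ⊎ Derivable P →
              Good X P ⊎ Derivable P
    combine (inj₁ w) (inj₁ d) (inj₁ b) = inj₁ (mkGood w d b)
    combine (inj₂ e) _ _ = inj₂ e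
    combine _ (inj₂ e) _ = inj₂ e
    combine _ _ (inj₂ e) = inj₂ e

  survivors : ∃ λ X → Exhaustive X × X ⊆ splits Imps × (∀ {P} → P ∈ X → Good X P)
  survivors = prune (splits Imps) (λ ex → good? ex)

  -- The countermodel of surviving sequents

  module Countermodel (X : List Sequent) (X⊆ : X ⊆ splits Imps) (good : ∀ {P} → P ∈ X → Good X P) where

    private variable
      P : Sequent

    cover : P ∈ X → φ ∈ S → ψ ∈ S → φ ≤[ P ] ψ ⊎ φ ⇒ ψ ∈ proj₂ P
    cover P∈ φ∈ ψ∈ = splits-cover (X⊆ P∈) (⇒∈Imps φ∈ ψ∈)

    exclude : P ∈ X → φ ∈ S → ψ ∈ S → χ ∈ S → ∀ {R} → R ∈ rules φ ψ χ → ¬ R ⊑ˢ P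
    exclude P∈ φ∈ ψ∈ χ∈ = Good.wf (good P∈) φ∈ ψ∈ χ∈

    -- A survivor decides the conclusion, and placing it on the right would complete a forbidden
    -- pattern.
    infer : P ∈ X → φ ∈ S → ψ ∈ S → χ ∈ S → ([] , [ α ⇒ β ]) ∈ rules φ ψ χ →
            α ∈ S → β ∈ S → α ≤[ P ] β
    infer P∈ φ∈ ψ∈ χ∈ r α∈ β∈ =
      [ id , (λ out → ⊥-elim (exclude P∈ φ∈ ψ∈ χ∈ r ((λ ()) , λ { #0 → out }))) ]′ (cover P∈ α∈ β∈)

    infer₁ : P ∈ X → φ ∈ S → ψ ∈ S → χ ∈ S → ([ γ ] , [ α ⇒ β ]) ∈ rules φ ψ χ →
             α ∈ S → β ∈ S → γ ∈ proj₁ P → α ≤[ P ] β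
    infer₁ P∈ φ∈ ψ∈ χ∈ r α∈ β∈ p =
      [ id , (λ out → ⊥-elim (exclude P∈ φ∈ ψ∈ χ∈ r ((λ { #0 → p }) , λ { #0 → out }))) ]′ (cover P∈ α∈ β∈)

    infer₂ : P ∈ X → φ ∈ S → ψ ∈ S → χ ∈ S → (γ ∷ δ ∷ [] , [ α ⇒ β ]) ∈ rules φ ψ χ →
             α ∈ S → β ∈ S → γ ∈ proj₁ P → δ ∈ proj₁ P → α ≤[ P ] β
    infer₂ P∈ φ∈ ψ∈ χ∈ r α∈ β∈ p q =
      [ id , (λ out → ⊥-elim (exclude P∈ φ∈ ψ∈ χ∈ r ((λ { #0 → p ; #1 → q }) , λ { #0 → out }))) ]′ (cover P∈ α∈ β∈)

    consistent : P ∈ X → φ ∈ S → ψ ∈ S → φ ≤[ P ] ψ → ¬ φ ⇒ ψ ∈ proj₂ P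
    consistent P∈ φ∈ ψ∈ p q = exclude P∈ φ∈ ψ∈ φ∈ rule-consistent ((λ { #0 → p }) , (λ { #0 → q }))

    ≤-refl : P ∈ X → φ ∈ S → φ ≤[ P ] φ
    ≤-refl P∈ φ∈ = infer P∈ φ∈ φ∈ φ∈ rule-refl φ∈ φ∈

    ≤-trans : P ∈ X → φ ∈ S → ψ ∈ S → χ ∈ S → φ ≤[ P ] ψ → ψ ≤[ P ] χ → φ ≤[ P ] χ
    ≤-trans P∈ φ∈ ψ∈ χ∈ = infer₂ P∈ φ∈ ψ∈ χ∈ rule-trans φ∈ χ∈

    ≤-total : P ∈ X → φ ∈ S → ψ ∈ S → φ ≤[ P ] ψ ⊎ ψ ≤[ P ] φ
    ≤-total P∈ φ∈ ψ∈ with cover P∈ φ∈ ψ∈ | cover P∈ ψ∈ φ∈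
    ... | inj₁ p | _ = inj₁ p
    ... | inj₂ _ | inj₁ q = inj₂ q
    ... | inj₂ p | inj₂ q = ⊥-elim (exclude P∈ φ∈ ψ∈ φ∈ rule-total ((λ ()) , λ { #0 → p ; #1 → q }))

    ⊤≰⊥ : P ∈ X → ¬ ⊤̇ ≤[ P ] ⊥̇
    ⊤≰⊥ P∈ p = exclude P∈ ⊥∈S ⊥∈S ⊥∈S rule-⊤≰⊥ ((λ { #0 → p }) , λ ())

    ⊥-min : P ∈ X → φ ∈ S → ⊥̇ ≤[ P ] φ
    ⊥-min P∈ φ∈ = infer P∈ φ∈ φ∈ φ∈ rule-⊥ ⊥∈S φ∈

    ⊤-max : P ∈ X → φ ∈ S → φ ≤[ P ] ⊤̇
    ⊤-max P∈ φ∈ = infer P∈ φ∈ φ∈ φ∈ rule-⊤ φ∈ ⊤∈S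

    -- Supplies the new level in both confluence properties and the critical level of a box;
    -- `origin` tells why the minimum is where it is.
    record Minimum (P : Sequent) (K : Form → Set) (χ : Form) : Set where
      constructor minimal
      field
        {μ}    : Form
        μ∈     : μ ∈ S
        μ≤χ    : μ ≤[ P ] χ
        μ≤     : φ ∈ S → K φ → μ ≤[ P ] φ
        origin : χ ≤[ P ] μ ⊎ K μ

    minimum : P ∈ X → {K : Form → Set} → (∀ φ → Dec (K φ)) → χ ∈ S → Minimum P K χ
    minimum {P} {χ} P∈ {K} K? χ∈ = let μ , μ∈ , p , q , r = go S id in minimal μ∈ p q r
      where
      go : ∀ L → L ⊆ S → ∃ λ μ → μ ∈ S × μ ≤[ P ] χ ×
           (∀ {φ} → φ ∈ L → K φ → μ ≤[ P ] φ) × (χ ≤[ P ] μ ⊎ K μ)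
      go [] _ = χ , χ∈ , ≤-refl P∈ χ∈ , (λ ()) , inj₁ (≤-refl P∈ χ∈)
      go (δ ∷ L) L⊆ with go L (L⊆ ∘ there) | K? δ
      ... | μ , μ∈ , μ≤χ , μ≤ , e | no ¬Kδ =
          μ , μ∈ , μ≤χ , (λ { #0 Kδ → ⊥-elim (¬Kδ Kδ) ; (there x) → μ≤ x }) , e
      ... | μ , μ∈ , μ≤χ , μ≤ , e | yes Kδ with ≤-total P∈ μ∈ (L⊆ #0)
      ...   | inj₁ μ≤δ = μ , μ∈ , μ≤χ , (λ { #0 _ → μ≤δ ; (there x) → μ≤ x }) , e
      ...   | inj₂ δ≤μ = δ , δ∈ , ≤-trans P∈ δ∈ μ∈ χ∈ δ≤μ μ≤χ ,
                (λ { #0 _ → ≤-refl P∈ δ∈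
                   ; (there x) Kx → ≤-trans P∈ δ∈ μ∈ (L⊆ (there x)) δ≤μ (μ≤ x Kx) }) , inj₂ Kδ
        where δ∈ = L⊆ #0

    -- The world (P , χ) is the point of the chain P from which χ is true.
    record World : Set where
      constructor world
      field
        {state}  : Sequent
        state∈   : state ∈ X
        {level}  : Form
        level∈   : level ∈ S
        level≰⊥  : ¬ level ≤[ state ] ⊥̇

    open World

    Holds : World → Form → Set
    Holds w φ = level w ≤[ state w ] φ

    Seen : World → Form → Form → Set
    Seen w = Below (state w) (level w)

    infix 4 _≼_ _⊑_

    -- Lowering the level makes more formulas true, so levels descend along the intuitionistic
    -- order.
    _≼_ : World → World → Set
    w ≼ v = state w ≡ state v × level v ≤[ state w ] level w

    -- With `⊤̇` on the left of the comparisons, `down` reflects true diamonds from `v` to `w` and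
    -- `up` carries true boxes from `w` to `v`.
    record _⊑_ (w v : World) : Set where
      field
        down : β ∈ S → δ ∈ S → β ∈ boxes S → δ ∈ dias S → Seen v β δ → Seen w β δ
        up   : β ∈ S → δ ∈ S → β ∈ boxes S → δ ∈ dias S → Seen w δ β → Seen v δ β

    open _⊑_

    Holds-mono : ∀ w v → w ≼ v → φ ∈ S → Holds w φ → Holds v φ
    Holds-mono w v (refl , v≤w) φ∈ = ≤-trans (state∈ w) (level∈ v) (level∈ w) φ∈ v≤w

    ⊑-refl : ∀ {w} → w ⊑ w
    ⊑-refl = record { down = λ _ _ _ _ → id ; up = λ _ _ _ _ → id }

    ⊑-trans : ∀ {u v w} → u ⊑ v → v ⊑ w → u ⊑ w
    ⊑-trans p q = record
      { down = λ a b c d → down p a b c d ∘ down q a b c d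
      ; up   = λ a b c d → up q a b c d ∘ up p a b c d }

    ≼-trans : ∀ {u v w} → u ≼ v → v ≼ w → u ≼ w
    ≼-trans {u} {v} {w} (refl , p) (refl , q) = refl , ≤-trans (state∈ u) (level∈ w) (level∈ v) (level∈ u) q p

    ≼-linear : ∀ {w u v} → w ≼ u → w ≼ v → u ≼ v ⊎ v ≼ u
    ≼-linear {w} {u} {v} (refl , _) (refl , _) =
      Sum.map (refl ,_) (refl ,_) (≤-total (state∈ w) (level∈ v) (level∈ u))

    -- The boxes true at w′ have to be true at v′; the lowest admissible level of v is used.
    forth : ∀ {w w′ v} → w ≼ w′ → w ⊑ v → ∃ λ v′ → v ≼ v′ × w′ ⊑ v′
    forth {w} {w′} {v} w≼w′@(refl , c′≤c) w⊑v = v′ , (refl , μ≤χ) , record { down = down′ ; up = up′ }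
      where
      P∈ = state∈ w′
      Q∈ = state∈ v
      Entered : Form → Set
      Entered β = β ∈ boxes S × Holds w′ β
      open Minimum (minimum Q∈ {Entered}
        (λ β → (β ∈? boxes S) ×-dec (level w′ ⇒ β ∈? proj₁ (state w′))) (level∈ v))

      -- The level `μ` is that of `v`, or a box true at `w′`; either way `down` returns diamonds
      -- true at `μ` to `w′`. Taking `⊥̇` as the diamond shows that `v′` is consistent.
      late : δ ∈ S → δ ∈ dias S → μ ≤[ state v ] δ → Holds w′ δ
      late δ∈ δ◇ μ≤δ with origin
      ... | inj₁ d≤μ =
        [ Holds-mono w w′ w≼w′ δ∈ , ≤-trans P∈ (level∈ w′) ⊤∈S δ∈ (⊤-max P∈ (level∈ w′)) ]′
        (down w⊑v ⊤∈S δ∈ #0 δ◇ (inj₁ (≤-trans Q∈ (level∈ v) μ∈ δ∈ d≤μ μ≤δ)))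
      ... | inj₂ (μ□ , c′≤μ) =
        [ Holds-mono w w′ w≼w′ δ∈ , ≤-trans P∈ (level∈ w′) μ∈ δ∈ c′≤μ ]′ (down w⊑v μ∈ δ∈ μ□ δ◇ (inj₂ μ≤δ))

      v′ : World
      v′ = world Q∈ μ∈ λ μ≤⊥ → level≰⊥ w′ (late ⊥∈S #0 μ≤⊥)

      down′ : β ∈ S → δ ∈ S → β ∈ boxes S → δ ∈ dias S → Seen v′ β δ → Seen w′ β δ
      down′ β∈ δ∈ β□ δ◇ (inj₁ μ≤δ) = inj₁ (late δ∈ δ◇ μ≤δ)
      down′ β∈ δ∈ β□ δ◇ (inj₂ β≤δ) = Sum.map₁ (Holds-mono w w′ w≼w′ δ∈) (down w⊑v β∈ δ∈ β□ δ◇ (inj₂ β≤δ))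

      up′ : β ∈ S → δ ∈ S → β ∈ boxes S → δ ∈ dias S → Seen w′ δ β → Seen v′ δ β
      up′ β∈ δ∈ β□ δ◇ (inj₁ c′≤β) = inj₁ (μ≤ β∈ (β□ , c′≤β))
      up′ β∈ δ∈ β□ δ◇ (inj₂ δ≤β) = Sum.map₁ (≤-trans Q∈ μ∈ (level∈ v) β∈ μ≤χ) (up w⊑v β∈ δ∈ β□ δ◇ (inj₂ δ≤β))

    -- Dually, the diamonds true at v′ have to be true at w′.
    back : ∀ {w v v′} → w ⊑ v → v ≼ v′ → ∃ λ w′ → w ≼ w′ × w′ ⊑ v′
    back {w} {v} {v′} w⊑v v≼v′@(refl , d′≤d) = w′ , (refl , μ≤χ) , record { down = down′ ; up = up′ }
      where
      P∈ = state∈ w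
      Q∈ = state∈ v′
      Entered : Form → Set
      Entered δ = δ ∈ dias S × Holds v′ δ
      open Minimum (minimum P∈ {Entered}
        (λ δ → (δ ∈? dias S) ×-dec (level v′ ⇒ δ ∈? proj₁ (state v′))) (level∈ w))

      -- Here `up` is used, with `⊤̇` counted as a diamond and `⊥̇` as a box.
      late : β ∈ S → β ∈ boxes S → μ ≤[ state w ] β → Holds v′ β
      late β∈ β□ μ≤β with origin
      ... | inj₁ c≤μ =
        [ Holds-mono v v′ v≼v′ β∈ , ≤-trans Q∈ (level∈ v′) ⊤∈S β∈ (⊤-max Q∈ (level∈ v′)) ]′
        (up w⊑v β∈ ⊤∈S β□ #1 (inj₁ (≤-trans P∈ (level∈ w) μ∈ β∈ c≤μ μ≤β)))
      ... | inj₂ (μ◇ , d′≤μ) =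
        [ Holds-mono v v′ v≼v′ β∈ , ≤-trans Q∈ (level∈ v′) μ∈ β∈ d′≤μ ]′ (up w⊑v β∈ μ∈ β□ μ◇ (inj₂ μ≤β))

      w′ : World
      w′ = world P∈ μ∈ λ μ≤⊥ → level≰⊥ v′ (late ⊥∈S #1 μ≤⊥)

      down′ : β ∈ S → δ ∈ S → β ∈ boxes S → δ ∈ dias S → Seen v′ β δ → Seen w′ β δ
      down′ β∈ δ∈ β□ δ◇ (inj₁ d′≤δ) = inj₁ (μ≤ δ∈ (δ◇ , d′≤δ))
      down′ β∈ δ∈ β□ δ◇ (inj₂ β≤δ) = Sum.map₁ (≤-trans P∈ μ∈ (level∈ w) δ∈ μ≤χ) (down w⊑v β∈ δ∈ β□ δ◇ (inj₂ β≤δ))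

      up′ : β ∈ S → δ ∈ S → β ∈ boxes S → δ ∈ dias S → Seen w′ δ β → Seen v′ δ β
      up′ β∈ δ∈ β□ δ◇ (inj₁ μ≤β) = inj₁ (late β∈ β□ μ≤β)
      up′ β∈ δ∈ β□ δ◇ (inj₂ δ≤β) = Sum.map₁ (Holds-mono v v′ v≼v′ β∈) (up w⊑v β∈ δ∈ β□ δ◇ (inj₂ δ≤β))

    model : Model
    model = record
      { World    = World
      ; _≼_      = _≼_
      ; _⊑_      = _⊑_
      -- Membership in `S` is recorded because `Holds-mono` covers only members of `S`.
      ; V        = λ w p → var p ∈ S × Holds w (var p)
      ; ≼-refl   = λ {w} → refl , ≤-refl (state∈ w) (level∈ w)
      ; ≼-trans  = λ {u} {v} {w} → ≼-trans {u} {v} {w}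
      ; ⊑-refl   = ⊑-refl
      ; ⊑-trans  = ⊑-trans
      ; ≼-linear = λ {w} {u} {v} → ≼-linear {w} {u} {v}
      ; forth    = λ {w} {w′} {v} → forth {w} {w′} {v}
      ; back     = λ {w} {v} {v′} → back {w} {v} {v′}
      ; V-mono   = λ {w} {v} w≼v (p∈ , h) → p∈ , Holds-mono w v w≼v p∈ h
      }

    open Model model using (_⊩_; sound)

    -- The root of the chain `Q`, since every level lies below `⊤̇`.
    top : ∀ {Q} → Q ∈ X → World
    top Q∈ = world Q∈ ⊤∈S (⊤≰⊥ Q∈)

    -- At level `⊤̇` a seen comparison is one that `Q` itself contains; one that `w` fails to see is
    -- in `lower` and hence refuted by `Q`.
    witness-⊑ : ∀ w {Q} (Q∈ : Q ∈ X) → upper (state w) (level w) ⊆ proj₁ Q →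
                lower (state w) (level w) ⊆ proj₂ Q → w ⊑ top Q∈
    witness-⊑ w {Q} Q∈ upper⊆Q lower⊆Q = record { down = down′ ; up = up′ }
      where
      P∈ = state∈ w

      down′ : β ∈ S → δ ∈ S → β ∈ boxes S → δ ∈ dias S → Seen (top Q∈) β δ → Seen w β δ
      down′ β∈ δ∈ β□ δ◇ seen with cover P∈ (level∈ w) δ∈ | cover P∈ β∈ δ∈
      ... | inj₁ p | _ = inj₁ p
      ... | inj₂ _ | inj₁ q = inj₂ q
      ... | inj₂ p | inj₂ q = ⊥-elim (consistent Q∈ β∈ δ∈
        ([ ≤-trans Q∈ β∈ ⊤∈S δ∈ (⊤-max Q∈ β∈) , id ]′ seen)
        (lower⊆Q (∈-map∘filter⁺ imp (lower? (state w) (level w))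
          (_ , ∈-cartesianProduct⁺ β∈ δ∈ , refl , β□ , δ◇ , p , q))))

      up′ : β ∈ S → δ ∈ S → β ∈ boxes S → δ ∈ dias S → Seen w δ β → Seen (top Q∈) δ β
      up′ β∈ δ∈ β□ δ◇ seen = inj₂
        (upper⊆Q (∈-map∘filter⁺ imp (upper? (state w) (level w))
          (_ , ∈-cartesianProduct⁺ δ∈ β∈ , refl , δ◇ , β□ , seen)))

    Holds-stable : ∀ w → φ ∈ S → ¬ ¬ Holds w φ → Holds w φ
    Holds-stable w φ∈ h with cover (state∈ w) (level∈ w) φ∈
    ... | inj₁ p = p
    ... | inj₂ q = ⊥-elim (h λ p → consistent (state∈ w) (level∈ w) φ∈ p q)

    -- The truth lemma

    Truth : Form → Set
    Truth φ = ∀ w → (Holds w φ → w ⊩ φ) × (w ⊩ φ → Holds w φ)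

    truth-∧ : φ ∈ S → ψ ∈ S → φ ∧̇ ψ ∈ S → Truth φ → Truth ψ → Truth (φ ∧̇ ψ)
    truth-∧ φ∈ ψ∈ ∧∈ tφ tψ w =
      (λ h → proj₁ (tφ w) (≤-trans P∈ χ∈ ∧∈ φ∈ h (infer P∈ φ∈ ψ∈ χ∈ rule-∧₁ ∧∈ φ∈))
           , proj₁ (tψ w) (≤-trans P∈ χ∈ ∧∈ ψ∈ h (infer P∈ φ∈ ψ∈ χ∈ rule-∧₂ ∧∈ ψ∈))) ,
      λ (x , y) → infer₂ P∈ φ∈ ψ∈ χ∈ rule-∧ χ∈ ∧∈ (proj₂ (tφ w) x) (proj₂ (tψ w) y)
      where
      P∈ = state∈ w
      χ∈ = level∈ w

    truth-∨ : φ ∈ S → ψ ∈ S → φ ∨̇ ψ ∈ S → Truth φ → Truth ψ → Truth (φ ∨̇ ψ)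
    truth-∨ {φ} {ψ} φ∈ ψ∈ ∨∈ tφ tψ w = to , λ x → Holds-stable w ∨∈ λ κ → x
      [ (λ y → κ (≤-trans P∈ χ∈ φ∈ ∨∈ (proj₂ (tφ w) y) (infer P∈ φ∈ ψ∈ χ∈ rule-∨₁ φ∈ ∨∈)))
      , (λ y → κ (≤-trans P∈ χ∈ ψ∈ ∨∈ (proj₂ (tψ w) y) (infer P∈ φ∈ ψ∈ χ∈ rule-∨₂ ψ∈ ∨∈))) ]′
      where
      P∈ = state∈ w
      χ∈ = level∈ w

      to : Holds w (φ ∨̇ ψ) → w ⊩ φ ∨̇ ψ
      to h κ with ≤-total P∈ φ∈ ψ∈
      ... | inj₁ φ≤ψ = κ (inj₂ (proj₁ (tψ w) (≤-trans P∈ χ∈ ∨∈ ψ∈ h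
                         (infer₂ P∈ φ∈ ψ∈ ψ∈ rule-∨ ∨∈ ψ∈ φ≤ψ (≤-refl P∈ ψ∈)))))
      ... | inj₂ ψ≤φ = κ (inj₁ (proj₁ (tφ w) (≤-trans P∈ χ∈ ∨∈ φ∈ h
                         (infer₂ P∈ φ∈ ψ∈ φ∈ rule-∨ ∨∈ φ∈ (≤-refl P∈ φ∈) ψ≤φ))))

    truth-⇒ : φ ∈ S → ψ ∈ S → φ ⇒ ψ ∈ S → Truth φ → Truth ψ → Truth (φ ⇒ ψ)
    truth-⇒ {φ} {ψ} φ∈ ψ∈ ⇒∈ tφ tψ w = to , from
      where
      P∈ = state∈ w
      χ∈ = level∈ w

      to : Holds w (φ ⇒ ψ) → w ⊩ φ ⇒ ψ
      to h {v} w≼v x = proj₁ (tψ v) (infer₂ (state∈ v) φ∈ ψ∈ (level∈ v) rule-mp (level∈ v) ψ∈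
        (proj₂ (tφ v) x) (Holds-mono w v w≼v ⇒∈ h))

      from : w ⊩ φ ⇒ ψ → Holds w (φ ⇒ ψ)
      from x with ≤-total P∈ χ∈ φ∈
      ... | inj₁ χ≤φ = ≤-trans P∈ χ∈ ψ∈ ⇒∈
        (proj₂ (tψ w) (x (refl , ≤-refl P∈ χ∈) (proj₁ (tφ w) χ≤φ)))
        (infer P∈ φ∈ ψ∈ χ∈ rule-K ψ∈ ⇒∈)
      ... | inj₂ φ≤χ =
        ≤-trans P∈ χ∈ ⊤∈S ⇒∈ (⊤-max P∈ χ∈) (infer₁ P∈ φ∈ ψ∈ χ∈ rule-⇒ ⊤∈S ⇒∈ φ≤ψ)
        where
        -- Evaluate the implication at level `φ`, the first at which `φ` is true; this is a world
        -- unless `φ` lies below `⊥̇`.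
        φ≤ψ : φ ≤[ state w ] ψ
        φ≤ψ with cover P∈ φ∈ ⊥∈S
        ... | inj₁ φ≤⊥ = ≤-trans P∈ φ∈ ⊥∈S ψ∈ φ≤⊥ (⊥-min P∈ ψ∈)
        ... | inj₂ φ≰⊥ = proj₂ (tψ v) (x (refl , φ≤χ) (proj₁ (tφ v) (≤-refl P∈ φ∈)))
          where
          v : World
          v = world P∈ φ∈ λ φ≤⊥ → consistent P∈ φ∈ ⊥∈S φ≤⊥ φ≰⊥

    truth-◇ : φ ∈ S → ◇ φ ∈ S → Truth φ → Truth (◇ φ)
    truth-◇ {φ} φ∈ ◇∈ tφ w = to , from
      where
      P∈ = state∈ w
      χ∈ = level∈ w

      -- The witness is attached to the level ◇ φ and transported to w by confluence.
      to : Holds w (◇ φ) → w ⊩ ◇ φ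
      to h κ with cover P∈ ◇∈ ⊥∈S
      ... | inj₁ ◇≤⊥ = level≰⊥ w (≤-trans P∈ χ∈ ◇∈ ⊥∈S h ◇≤⊥)
      ... | inj₂ ◇≰⊥ with Good.◇-wit (good P∈) φ∈ ◇∈ ◇≰⊥
      ...   | Q , Q∈ , upper⊆Q , lower⊆Q =
        found (forth {u} {w} {top Q∈} (refl , h) (witness-⊑ u Q∈ (upper⊆Q ∘ there) lower⊆Q))
        where
        u : World
        u = world P∈ ◇∈ λ ◇≤⊥ → consistent P∈ ◇∈ ⊥∈S ◇≤⊥ ◇≰⊥

        found : ¬ ∃ λ v → top Q∈ ≼ v × w ⊑ v
        found (v , top≼v , w⊑v) =
          κ (v , w⊑v , proj₁ (tφ v) (Holds-mono (top Q∈) v top≼v φ∈ (upper⊆Q #0)))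

      from : w ⊩ ◇ φ → Holds w (◇ φ)
      -- `φ` gives `◇ φ` at `v`, and `down` from `⊤̇` returns it to `w`.
      from x = Holds-stable w ◇∈ λ κ → x λ (v , w⊑v , y) → κ
        ([ id , ≤-trans P∈ χ∈ ⊤∈S ◇∈ (⊤-max P∈ χ∈) ]′
          (down w⊑v ⊤∈S ◇∈ #0 (there (there (∈-map⁺ ◇ φ∈)))
            (inj₁ (≤-trans (state∈ v) (level∈ v) φ∈ ◇∈ (proj₂ (tφ v) y)
              (infer (state∈ v) φ∈ φ∈ φ∈ rule-◇ φ∈ ◇∈)))))

    truth-□ : φ ∈ S → □ φ ∈ S → Truth φ → Truth (□ φ)
    truth-□ {φ} φ∈ □∈ tφ w = to , from
      where
      P∈ = state∈ w
      χ∈ = level∈ w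

      to : Holds w (□ φ) → w ⊩ □ φ
      -- `up` from `⊤̇` carries `□ φ` to `v`, where reflexivity of the box applies.
      to h {u} {v} w≼u u⊑v = proj₁ (tφ v) (≤-trans (state∈ v) (level∈ v) □∈ φ∈
        ([ id , ≤-trans (state∈ v) (level∈ v) ⊤∈S □∈ (⊤-max (state∈ v) (level∈ v)) ]′
          (up u⊑v □∈ ⊤∈S (there (there (∈-map⁺ □ φ∈))) #1 (inj₁ (Holds-mono w u w≼u □∈ h))))
        (infer (state∈ v) φ∈ φ∈ φ∈ rule-□ □∈ φ∈))

      -- The witness is attached to the last level before □ φ becomes true.
      from : w ⊩ □ φ → Holds w (□ φ)
      from x with cover P∈ χ∈ □∈
      ... | inj₁ h = h
      ... | inj₂ χ≰□ = ⊥-elim (refuted (Good.□-wit (good P∈) φ∈ □∈ μ∈ μ≰□ (All.tabulate above)))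
        where
        -- The formulas minimized over are those strictly above `□ φ`, so `μ` is the next value
        -- after `□ φ`.
        open Minimum (minimum P∈ {λ δ → δ ⇒ □ φ ∈ proj₂ (state w)}
          (λ δ → δ ⇒ □ φ ∈? proj₂ (state w)) χ∈)

        μ≰□ : μ ⇒ □ φ ∈ proj₂ (state w)
        μ≰□ with origin | cover P∈ μ∈ □∈
        ... | inj₂ q | _ = q
        ... | inj₁ _ | inj₂ q = q
        ... | inj₁ χ≤μ | inj₁ p = ⊥-elim (consistent P∈ χ∈ □∈ (≤-trans P∈ χ∈ μ∈ □∈ χ≤μ p) χ≰□)

        above : δ ∈ S → μ ⇒ δ ∈ proj₂ (state w) → δ ≤[ state w ] □ φ
        above δ∈ q with cover P∈ δ∈ □∈
        ... | inj₁ p = p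
        ... | inj₂ r = ⊥-elim (consistent P∈ μ∈ δ∈ (μ≤ δ∈ r) q)

        u : World
        u = world P∈ μ∈ λ μ≤⊥ →
          consistent P∈ μ∈ □∈ (≤-trans P∈ μ∈ ⊥∈S □∈ μ≤⊥ (⊥-min P∈ □∈)) μ≰□

        refuted : ¬ ∃ λ Q → Q ∈ X × (upper (state w) μ , (⊤̇ ⇒ φ) ∷ lower (state w) μ) ⊑ˢ Q
        refuted (Q , Q∈ , upper⊆Q , lower⊆Q) = consistent Q∈ ⊤∈S φ∈
          (proj₂ (tφ (top Q∈)) (x {u} (refl , μ≤χ) (witness-⊑ u Q∈ upper⊆Q (lower⊆Q ∘ there))))
          (lower⊆Q #0)

    truth : ∀ φ → sub φ ⊆ S → Truth φ
    truth (var p) σ w =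
      (λ h κ → κ (σ #0 , h)) , λ x → Holds-stable w (σ #0) λ κ → x (κ ∘ proj₂)
    truth ⊥̇ σ w = level≰⊥ w , λ ()
    truth (φ ∧̇ ψ) σ = truth-∧ (subˡ φ ψ σ (self∈sub φ)) (subʳ φ ψ σ (self∈sub ψ)) (σ #0)
      (truth φ (subˡ φ ψ σ)) (truth ψ (subʳ φ ψ σ))
    truth (φ ∨̇ ψ) σ = truth-∨ (subˡ φ ψ σ (self∈sub φ)) (subʳ φ ψ σ (self∈sub ψ)) (σ #0)
      (truth φ (subˡ φ ψ σ)) (truth ψ (subʳ φ ψ σ))
    truth (φ ⇒ ψ) σ = truth-⇒ (subˡ φ ψ σ (self∈sub φ)) (subʳ φ ψ σ (self∈sub ψ)) (σ #0)
      (truth φ (subˡ φ ψ σ)) (truth ψ (subʳ φ ψ σ))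
    truth (◇ φ) σ = truth-◇ (σ (there (self∈sub φ))) (σ #0) (truth φ (σ ∘ there))
    truth (□ φ) σ = truth-□ (σ (there (self∈sub φ))) (σ #0) (truth φ (σ ∘ there))

    refute : ∀ {P} → P ∈ X → sub φ ⊆ S → ⊤̇ ⇒ φ ∈ proj₂ P → ¬ GS4 φ
    refute {φ} P∈ sub⊆ out d =
      consistent P∈ ⊤∈S (sub⊆ (self∈sub φ)) (proj₂ (truth φ sub⊆ (top P∈)) (sound d)) out

-- The decision procedure

mainTheorem5 : (φ : Form) → Dec (GS4 φ)
mainTheorem5 φ = decide survivors
  where
  open Elimination (⊥̇ ∷ ⊤̇ ∷ sub φ) #0 #1

  decide : (∃ λ X → Exhaustive X × X ⊆ splits Imps × (∀ {P} → P ∈ X → Good X P)) → Dec (GS4 φ)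
  -- A survivor refuting `⊤̇ ⇒ φ` falsifies `φ` at its root; without one, this implication is
  -- derivable.
  decide (X , ex , X⊆ , good) with search {R = [] , [ ⊤̇ ⇒ φ ]} ex (λ ())
                                  (λ { #0 → ⇒∈Imps #1 (there (there (self∈sub φ))) })
  ... | inj₁ (P , P∈ , _ , out) = no (Countermodel.refute X X⊆ good P∈ (there ∘ there) (out #0))
  ... | inj₂ d = yes (toGS4 (cases d (hyp #0 · ⊤̇-intro) (ax (efq _) · hyp #0)))
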